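{- A finite loopless graph is R-reduced if and only if it is a graph core.
   Context: Graphs are finite and undirected. For a finite set $B$ and a relation $R\subseteq V_G\times B$ with full image (every $b\in B$ has some $v$ with $(v,b)\in R$), $G\ast R$ is the graph with vertex set $B$ and edge set $\{(a,b)\in B\times B: \exists (u,v)\in E_G,\ (u,a)\in R,\ (v,b)\in R\}$. All relations here are required to have full domain (every $v\in V_G$ is related to some $b\in B$). For a subgraph $H$ of $G$, an R-retraction of $G$ to $H$ is a relation $R\subseteq V_G\times V_H$ with $G\ast R=H$ and $(x,x)\in R$ for all $x\in V_H$. A graph is R-reduced if it has no R-retraction to a proper subgraph. A retraction of $G$ to a subgraph $H$ is a graph homomorphism $r:G\to H$ with $r(x)=x$ for all $x\in V_H$; a graph core is a graph that has no retraction to a proper subgraph. -}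

module Defs where

open import Data.Fin.Base using (Fin)
open import Data.Fin.Properties using (any?)
open import Data.Product.Base using (Σ; ∃; ∃₂; _×_; _,_; map)
open import Data.Refinement.Base using (Refinement; _,_; value)
open import Function.Base using (_∘_; id)
open import Function.Bundles using (_↔_; module Inverse)
open import Level using (0ℓ)
open import Relation.Binary.Core using (Rel; REL; _⇔_)
open import Relation.Binary.Definitions using (Decidable; Symmetric)
open import Relation.Binary.Morphism.Structures using (IsRelHomomorphism)
open import Relation.Binary.PropositionalEquality using (_≡_; sym; subst)
open import Relation.Nullary.Decidable using (Dec; map′; _×-dec_)
open import Relation.Nullary.Negation using (¬_)
import Relation.Unary as U

Finite : Set → Set
Finite A = ∃ λ n → A ↔ Fin n

finite-any? : ∀ {A} → Finite A → {P : U.Pred A 0ℓ} → U.Decidable P → Dec (∃ P)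
finite-any? (_ , A↔Fin) {P} P? =
  map′ (map from id)
       (λ (x , px) → to x , subst P (sym (strictlyInverseʳ x)) px)
       (any? (P? ∘ from))
  where open Inverse A↔Fin

-- Subsets of finite sets (vertex sets, edge sets, relations) are decidable
-- predicates.

-- Loops are allowed.
record Graph (V : Set) : Set₁ where
  field
    finite   : Finite V
    Edge     : Rel V 0ℓ
    Edge?    : Decidable Edge
    edge-sym : Symmetric Edge

open Graph public

Loopless : ∀ {V} → Graph V → Set
Loopless G = ∀ v → ¬ Edge G v v

record Relation (V B : Set) : Set₁ where
  field
    codomain-finite : Finite B
    Related         : REL V B 0ℓ
    Related?        : Decidable Related
    full-domain     : ∀ v → ∃ λ b → Related v b
    full-image      : ∀ b → ∃ λ v → Related v b

open Relation public

infixl 7 _∗_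

_∗_ : ∀ {V B} → Graph V → Relation V B → Graph B
G ∗ R = record
  { finite   = codomain-finite R
  ; Edge     = λ a b → ∃₂ λ u v → Edge G u v × Related R u a × Related R v b
  ; Edge?    = λ a b →
      finite-any? (finite G) λ u → finite-any? (finite G) λ v →
        Edge? G u v ×-dec Related? R u a ×-dec Related? R v b
  ; edge-sym = λ (u , v , uv , ua , vb) → v , u , edge-sym G uv , vb , ua
  }

infix 4 _≈_

_≈_ : ∀ {V} → Graph V → Graph V → Set
G ≈ H = Edge G ⇔ Edge H

-- `Refinement` makes the membership proof irrelevant, so `VertexOf` has
-- exactly one element for each vertex of G satisfying `Member`.
record Subgraph {V : Set} (G : Graph V) : Set₁ where
  field
    Member  : U.Pred V 0ℓ
    Member? : U.Decidable Member

  VertexOf : Set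
  VertexOf = Refinement V Member

  field
    graph   : Graph VertexOf
    edges-⊆ : ∀ {a b} → Edge graph a b → Edge G (value a) (value b)

open Subgraph public

Proper : ∀ {V} {G : Graph V} → Subgraph G → Set
Proper {G = G} H =
  ¬ ((∀ v → Member H v) ×
     (∀ {a b} → Edge G (value a) (value b) → Edge (graph H) a b))

record RRetraction {V} (G : Graph V) (H : Subgraph G) : Set₁ where
  field
    relation  : Relation V (VertexOf H)
    image-≈   : G ∗ relation ≈ graph H
    reflexive : ∀ x → Related relation (value x) x

RReduced : ∀ {V} → Graph V → Set₁
RReduced G = ¬ Σ (Subgraph G) λ H → Proper H × RRetraction G H

record Retraction {V} (G : Graph V) (H : Subgraph G) : Set where
  field
    r     : V → VertexOf H
    isHom : IsRelHomomorphism (Edge G) (Edge (graph H)) r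
    fixes : ∀ x → r (value x) ≡ x

GraphCore : ∀ {V} → Graph V → Set₁
GraphCore G = ¬ Σ (Subgraph G) λ H → Proper H × Retraction G H

{-# OPTIONS --safe #-}
module Submission where

open import Defs
open import Function.Bundles using (_⇔_; mk⇔)
open import Data.Fin.Properties using (inj⇒≟)
open import Data.Irrelevant using ([_])
open import Data.Product.Base using (_,_; proj₁; proj₂)
open import Data.Refinement.Base using (_,_; value)
open import Function.Properties.Inverse using (↔⇒↣)
open import Relation.Binary.Definitions using (DecidableEquality)
open import Relation.Binary.Morphism.Structures using (IsRelHomomorphism)
open import Relation.Binary.PropositionalEquality using (_≡_; refl; subst₂)
open import Relation.Nullary.Decidable using (yes; no)
open import Relation.Nullary.Negation using (contradiction-irr)

-- For each fixed subgraph `H`, a retraction of `G` to `H` exists exactly when an R-retraction does,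
-- so both notions rule out the same proper subgraphs. A retraction, seen as a relation, is an
-- R-retraction; conversely, a suitable choice function inside an R-retraction is a retraction.

finite⇒≟ : ∀ {A} → Finite A → DecidableEquality A
finite⇒≟ (_ , A↔Fin) = inj⇒≟ (↔⇒↣ A↔Fin)

module _ {V : Set} {G : Graph V} {H : Subgraph G} where

  -- The relation is the graph of `r`. Edges of `G ∗ relation` are `r`-images of edges of `G`, hence
  -- lie in `H` as `r` is a homomorphism; conversely, each edge of `H` is an edge of `G` whose ends
  -- `r` fixes.
  retraction⇒RRetraction : Retraction G H → RRetraction G H
  retraction⇒RRetraction ret = record
    { relation  = record
      { codomain-finite = finite (graph H)
      ; Related         = λ v b → r v ≡ b
      ; Related?        = λ v b → finite⇒≟ (finite (graph H)) (r v) b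
      ; full-domain     = λ v → r v , refl
      ; full-image      = λ b → value b , fixes b
      }
    ; image-≈   =
        (λ (_ , _ , uv , ru≡a , rv≡b) → subst₂ (Edge (graph H)) ru≡a rv≡b (cong uv)) ,
        (λ {a} {b} ab → value a , value b , edges-⊆ H ab , fixes a , fixes b)
    ; reflexive = fixes
    }
    where
    open Retraction ret
    open IsRelHomomorphism isHom

  -- Any choice of r v among the vertices related to v is a homomorphism, because
  -- G ∗ R has no edges outside H; reflexivity lets the choice fix H pointwise.
  RRetraction⇒retraction : RRetraction G H → Retraction G H
  RRetraction⇒retraction rret = record
    { r     = r
    ; isHom = record
      { cong = λ {u} {v} uv → proj₁ image-≈ (u , v , uv , related-r u , related-r v) }
    ; fixes = fixes
    }
    where
    open RRetraction rret

    r : V → VertexOf H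
    r v with Member? H v
    ... | yes v∈H = v , [ v∈H ]
    ... | no  _   = proj₁ (full-domain relation v)

    related-r : ∀ v → Related relation v (r v)
    related-r v with Member? H v
    ... | yes v∈H = reflexive (v , [ v∈H ])
    ... | no  _   = proj₂ (full-domain relation v)

    fixes : ∀ x → r (value x) ≡ x
    fixes (v , [ v∈H ]) with Member? H v
    -- Membership proofs are irrelevant, so the one returned by `Member?` and the given `v∈H` yield
    -- the same vertex of `H`.
    ... | yes _   = refl
    ... | no  v∉H = contradiction-irr v∈H v∉H

proposition4p4p6 : ∀ {V : Set} (G : Graph V) → Loopless G → RReduced G ⇔ GraphCore G
proposition4p4p6 G _ = mk⇔
  (λ reduced (H , proper , ret)  → reduced (H , proper , retraction⇒RRetraction ret))
  (λ core    (H , proper , rret) → core (H , proper , RRetraction⇒retraction rret))
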